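{- Let $\mathbf v\in\mathbb{R}^\infty$, and let $\mathbf y=\mathbb{F}^{\rm S}\mathbf v$ and $\mathbf z=\mathbb{L}^{\rm S}\mathbf v$, where $\mathbb{F}^{\rm S}=(1,x(1+x))$ and $\mathbb{L}^{\rm S}=(1+2x,x(1+x))$. Let $D=(1,-x)=\mathrm{diag}(1,-1,1,\ldots)$ and $C(x)=\frac{1-\sqrt{1-4x}}{2x}$. Then: (a) $\left(\frac{1}{1+2xC(x)},xC(x)\right)\mathbf z=D(\mathbb{F}^{\rm S})^{ -1}D\,\mathbf y$; (b) $\left(\frac{1}{1-4x^2C(x)^2},xC(x)\right)\mathbf z=D(\mathbb{L}^{\rm S})^{ -1}D\,\mathbf y$; (c) $\left(1+2xC(x),xC(x)\right)\mathbf y=D(\mathbb{F}^{\rm S})^{ -1}D\,\mathbf z$; (d) $\left(\frac{1+2xC(x)}{1-2xC(x)},xC(x)\right)\mathbf y=D(\mathbb{L}^{\rm S})^{ -1}D\,\mathbf z$.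
   Context: $\mathbb{R}^\infty$ is the space of real column vectors $[v_0,v_1,\ldots]^T$, identified with generating functions. For formal power series $g(x)$ with $g(0)\neq 0$ and $f(x)$ with $f(0)=0$, $f'(0)\ne0$, $(g(x),f(x))$ denotes the (Riordan) infinite lower triangular matrix whose $j$-th column has generating function $g(x)f(x)^j$; it maps a vector with generating function $U(x)$ to one with generating function $g(x)U(f(x))$. These matrices form a group with $(g,f)(h,l)=(g\cdot h(f),l(f))$ and $(g,f)^{ -1}=(1/g(\bar f),\bar f)$, $\bar f$ the compositional inverse of $f$. -}

module Defs where

open import Level using (_⊔_)
open import Algebra.Bundles using (RawSemiring; Semiring; CommutativeRing)
open import Algebra.Apartness.Bundles using (HeytingField; HeytingCommutativeRing)
open import Data.Nat.Base using (ℕ; zero; suc; _∸_; _≤_; _<_; z≤n; s≤s)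
import Data.Nat.Properties as ℕ
open import Data.Nat.GeneralisedArithmetic using (fold)
open import Data.Nat.Induction using (<-rec)
open import Data.Fin.Base using (toℕ)
import Data.Fin.Properties as Fin
open import Data.Product.Base using (_,_; proj₁; proj₂)
open import Data.Sum.Base using (inj₁; inj₂)
open import Relation.Binary.PropositionalEquality.Core as ≡ using (_≡_)
import Algebra.Apartness.Properties.HeytingCommutativeRing as HeytingProperties
import Algebra.Definitions.RawSemiring as RawSemiringDefinitions
import Algebra.Properties.Ring as RingProperties
import Algebra.Properties.Semiring.Sum as SemiringSum
import Relation.Binary.Reasoning.Setoid as SetoidReasoning

TwoNonzero : ∀ {c ℓ₁ ℓ₂} → HeytingField c ℓ₁ ℓ₂ → Set ℓ₂
TwoNonzero K = 1# + 1# # 0#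
  where open HeytingField K

-- In a Heyting field "x ≠ 0" is the apartness x # 0#.
module RiordanMatrices {c ℓ₁ ℓ₂} (K : HeytingField c ℓ₁ ℓ₂) (2#0 : TwoNonzero K) where

  open HeytingField K
  open HeytingCommutativeRing heytingCommutativeRing using (commutativeRing)
  open CommutativeRing commutativeRing using (ring; semiring)
  open HeytingProperties heytingCommutativeRing
  open RingProperties ring using (-0#≈0#; -‿involutive; -‿distribʳ-*)
  open SemiringSum semiring
  open RawSemiringDefinitions (Semiring.rawSemiring semiring)
    using (_×_)

  x-x+y : ∀ x y → (x - y) + y ≈ x
  x-x+y x y = trans (+-assoc x (- y) y) (trans (+-congˡ (-‿inverseˡ y)) (+-identityʳ x))

  inv : ∀ x → x # 0# → Carrier
  inv x x#0 = proj₁ (#⇒invertible x#0)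

  inv-inverseˡ : ∀ x (x#0 : x # 0#) → inv x x#0 * x ≈ 1#
  inv-inverseˡ x x#0 =
    trans (*-congˡ (sym (x-0≈x x))) (proj₁ (proj₂ (#⇒invertible x#0)))

  inv-inverseʳ : ∀ x (x#0 : x # 0#) → x * inv x x#0 ≈ 1#
  inv-inverseʳ x x#0 = trans (*-comm _ _) (inv-inverseˡ x x#0)

  inv#0 : ∀ x (x#0 : x # 0#) → inv x x#0 # 0#
  inv#0 x x#0 = invertibleʳ⇒# (x , trans (*-congʳ (x-0≈x _)) (inv-inverseˡ x x#0))

  ½ : Carrier
  ½ = inv (1# + 1#) 2#0

  -- Infinite column vectors, identified with their generating functions.
  Series : Set c
  Series = ℕ → Carrier

  infix 4 _≋_
  _≋_ : Series → Series → Set ℓ₁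
  a ≋ b = ∀ n → a n ≈ b n

  𝟘 𝟙 X : Series
  𝟘 _ = 0#

  𝟙 zero    = 1#
  𝟙 (suc _) = 0#

  X zero          = 0#
  X (suc zero)    = 1#
  X (suc (suc _)) = 0#

  κ : ℕ → Series
  κ m zero    = m × 1#
  κ m (suc _) = 0#

  infixl 6 _⊕_ _⊖_
  infixl 7 _⊗_

  _⊕_ _⊖_ _⊗_ : Series → Series → Series
  (a ⊕ b) n = a n + b n
  (a ⊖ b) n = a n - b n
  (a ⊗ b) n = ∑[ k ≤ n ] (a (n ∸ toℕ k) * b (toℕ k))

  ⊝_ : Series → Series
  (⊝ a) n = - a n

  infix 8 ⊝_

  rawSemiring : RawSemiring c ℓ₁
  rawSemiring = record
    { Carrier = Series ; _≈_ = _≋_ ; _+_ = _⊕_ ; _*_ = _⊗_ ; 0# = 𝟘 ; 1# = 𝟙 }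

  open RawSemiringDefinitions rawSemiring public using (_^_)

  -- If the n-th coefficient of Φ a only depends on the coefficients of a below
  -- n, then fix Φ is the series satisfying a ≋ Φ a (see fix-unfold).
  fix : (Series → Series) → Series
  fix Φ n = fold 𝟘 Φ (suc n) n

  Matrix : Set c
  Matrix = ℕ → ℕ → Carrier

  record LowerTriangular : Set (c ⊔ ℓ₁ ⊔ ℓ₂) where
    field
      entry    : Matrix
      upper≈0  : ∀ i j → i < j → entry i j ≈ 0#
      diagonal : ∀ i → entry i i # 0#

  open LowerTriangular public

  -- The matrix-vector product for a lower triangular m: the terms with
  -- column index k > i, which vanish, are left out.
  apply : Matrix → Series → Series
  apply m v i = ∑[ k ≤ i ] (m i (toℕ k) * v (toℕ k))

  infixr 7 _·_
  _·_ : LowerTriangular → Series → Series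
  M · v = apply (entry M) v

  -- Forward substitution: for a lower triangular m whose diagonal entries have
  -- the inverses d, the fixed point r of substitute m d v is the solution of
  -- m r = v.
  substitute : Matrix → (ℕ → Carrier) → Series → Series → Series
  substitute m d v r i = d i * (v i - ∑[ k < i ] (m i (toℕ k) * r (toℕ k)))

  solve : Matrix → (ℕ → Carrier) → Series → Series
  solve m d v = fix (substitute m d v)

  unit : ℕ → Series
  unit zero    zero    = 1#
  unit zero    (suc _) = 0#
  unit (suc _) zero    = 0#
  unit (suc j) (suc i) = unit j i

  open module ≈-Reasoning = SetoidReasoning setoid

  Σ< : ℕ → Series → Carrier
  Σ< n f = ∑[ k < n ] f (toℕ k)

  Σ<-suc : ∀ n f → Σ< (suc n) f ≈ Σ< n f + f n
  Σ<-suc n f = trans (sum-init-last {n} (λ k → f (toℕ k)))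
    (+-cong (sum-cong-≋ {n} (λ k → reflexive (≡.cong f (Fin.toℕ-inject₁ k))))
            (reflexive (≡.cong f (Fin.toℕ-fromℕ n))))

  Σ<-cong : ∀ n f g → (∀ k → k < n → f k ≈ g k) → Σ< n f ≈ Σ< n g
  Σ<-cong n f g p = sum-cong-≋ {n} (λ k → p (toℕ k) (Fin.toℕ<n k))

  Σ<-zero : ∀ n f → (∀ k → k < n → f k ≈ 0#) → Σ< n f ≈ 0#
  Σ<-zero n f p = trans (Σ<-cong n f 𝟘 p) (sum-replicate-zero n)

  Σ<-extend : ∀ {m n} f → m ≤ n → (∀ k → m ≤ k → k < n → f k ≈ 0#) → Σ< n f ≈ Σ< m f
  Σ<-extend {m} {zero}  f z≤n p = refl
  Σ<-extend {m} {suc n} f m≤n p with ℕ.m≤n⇒m<n∨m≡n m≤n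
  ... | inj₂ ≡.refl = refl
  ... | inj₁ (s≤s m≤n′) = begin
    Σ< (suc n) f    ≈⟨ Σ<-suc n f ⟩
    Σ< n f + f n    ≈⟨ +-cong (Σ<-extend f m≤n′ (λ k m≤k k<n → p k m≤k (ℕ.m<n⇒m<1+n k<n))) (p n m≤n′ (ℕ.n<1+n n)) ⟩
    Σ< m f + 0#     ≈⟨ +-identityʳ _ ⟩
    Σ< m f          ∎

  Σ<-last : ∀ n f → (∀ k → k < n → f k ≈ 0#) → Σ< (suc n) f ≈ f n
  Σ<-last n f p = trans (Σ<-suc n f) (trans (+-congʳ (Σ<-zero n f p)) (+-identityˡ _))

  unit-diag : ∀ n → unit n n ≈ 1#
  unit-diag zero    = refl
  unit-diag (suc n) = unit-diag n

  unit-upper : ∀ {i j} → i < j → unit j i ≈ 0#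
  unit-upper {zero}  {suc j} _         = refl
  unit-upper {suc i} {suc j} (s≤s i<j) = unit-upper i<j

  unit-lower : ∀ {i j} → j < i → unit j i ≈ 0#
  unit-lower {suc i} {zero}  _         = refl
  unit-lower {suc i} {suc j} (s≤s j<i) = unit-lower j<i

  Causal : (Series → Series) → Set (c ⊔ ℓ₁)
  Causal Φ = ∀ {a b} n → (∀ k → k < n → a k ≈ b k) → Φ a n ≈ Φ b n

  fix-unfold : ∀ {Φ} → Causal Φ → fix Φ ≋ Φ (fix Φ)
  fix-unfold {Φ} causal n = causal n (λ k k<n → stable k<n (ℕ.n<1+n k))
    where
    stable : ∀ {m m′ k} → k < m → k < m′ → fold 𝟘 Φ m k ≈ fold 𝟘 Φ m′ k
    stable {suc m} {suc m′} {k} (s≤s k≤m) (s≤s k≤m′) =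
      causal k (λ j j<k → stable (ℕ.<-≤-trans j<k k≤m) (ℕ.<-≤-trans j<k k≤m′))

  substitute-causal : ∀ m d v → Causal (substitute m d v)
  substitute-causal m d v {a} {b} n p =
    *-congˡ (+-congˡ (-‿cong (Σ<-cong n (λ k → m n k * a k) (λ k → m n k * b k) (λ k k<n → *-congˡ (p k k<n)))))

  apply-solve : ∀ m d v → (∀ i → m i i * d i ≈ 1#) → apply m (solve m d v) ≋ v
  apply-solve m d v md≈1 i = begin
    Σ< (suc i) f                  ≈⟨ Σ<-suc i f ⟩
    Σ< i f + m i i * r i          ≈⟨ +-congˡ (*-congˡ (fix-unfold (substitute-causal m d v) i)) ⟩
    Σ< i f + m i i * (d i * w)    ≈⟨ +-congˡ (*-assoc _ _ _) ⟨
    Σ< i f + (m i i * d i) * w    ≈⟨ +-congˡ (*-congʳ (md≈1 i)) ⟩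
    Σ< i f + 1# * w               ≈⟨ +-congˡ (*-identityˡ w) ⟩
    Σ< i f + (v i - Σ< i f)       ≈⟨ +-comm _ _ ⟩
    (v i - Σ< i f) + Σ< i f       ≈⟨ x-x+y _ _ ⟩
    v i                           ∎
    where
    r = solve m d v
    f : Series
    f k = m i k * r k
    w = v i - Σ< i f

  -- The j-th column of M ⁻¹ is the solution r of M r = eⱼ.
  infix 8 _⁻¹
  _⁻¹ : LowerTriangular → LowerTriangular
  M ⁻¹ = record
    { entry    = λ i j → column j i
    ; upper≈0  = λ i j i<j → column-upper j i i<j
    ; diagonal = λ i → #-congʳ (sym (column-diag i)) (inv#0 _ (diagonal M i))
    }
    where
    d : ℕ → Carrier
    d i = inv (entry M i i) (diagonal M i)

    column : ℕ → Series
    column j = solve (entry M) d (unit j)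

    column-step : ∀ j i → (∀ k → k < i → column j k ≈ 0#) → column j i ≈ d i * unit j i
    column-step j i p = begin
      column j i                   ≈⟨ fix-unfold (substitute-causal (entry M) d (unit j)) i ⟩
      d i * (unit j i - Σ< i f)    ≈⟨ *-congˡ (+-congˡ (-‿cong (Σ<-zero i f (λ k k<i → trans (*-congˡ (p k k<i)) (zeroʳ _))))) ⟩
      d i * (unit j i - 0#)        ≈⟨ *-congˡ (x-0≈x _) ⟩
      d i * unit j i               ∎
      where
      f : Series
      f k = entry M i k * column j k

    column-upper : ∀ j i → i < j → column j i ≈ 0#
    column-upper j = <-rec _ λ i rec i<j →
      trans (column-step j i (λ k k<i → rec k<i (ℕ.<-trans k<i i<j)))
            (trans (*-congˡ (unit-upper i<j)) (zeroʳ _))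

    column-diag : ∀ i → column i i ≈ d i
    column-diag i = trans (column-step i i (λ k k<i → column-upper i k k<i))
                          (trans (*-congˡ (unit-diag i)) (*-identityʳ _))

  ·-cong : ∀ M {v w} → v ≋ w → M · v ≋ M · w
  ·-cong M {v} {w} v≋w i =
    Σ<-cong (suc i) (λ k → entry M i k * v k) (λ k → entry M i k * w k) (λ k _ → *-congˡ (v≋w k))

  ⁻¹-inverse-entry : ∀ M j → M · (λ i → entry (M ⁻¹) i j) ≋ unit j
  ⁻¹-inverse-entry M j =
    apply-solve (entry M) _ (unit j) (λ i → inv-inverseʳ _ (diagonal M i))

  ⁻¹-inverseʳ : ∀ M v → M · M ⁻¹ · v ≋ v
  ⁻¹-inverseʳ M v i = begin
    Σ< (suc i) (λ k → m i k * Σ< (suc k) (nv k))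
      ≈⟨ Σ<-cong (suc i) (λ k → m i k * Σ< (suc k) (nv k)) (λ k → m i k * Σ< (suc i) (nv k))
           (λ k k≤i → *-congˡ (sym (Σ<-extend (nv k) k≤i (λ j k<j _ →
             trans (*-congʳ (upper≈0 (M ⁻¹) k j k<j)) (zeroˡ (v j)))))) ⟩
    Σ< (suc i) (λ k → m i k * Σ< (suc i) (nv k))
      ≈⟨ Σ<-cong (suc i) (λ k → m i k * Σ< (suc i) (nv k)) (λ k → Σ< (suc i) (mnv k))
           (λ k _ → *-distribˡ-sum {suc i} (m i k) (λ j → nv k (toℕ j))) ⟩
    Σ< (suc i) (λ k → Σ< (suc i) (mnv k))
      ≈⟨ ∑-comm {suc i} {suc i} (λ k j → mnv (toℕ k) (toℕ j)) ⟩
    Σ< (suc i) (λ j → Σ< (suc i) (λ k → mnv k j))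
      ≈⟨ Σ<-cong (suc i) (λ j → Σ< (suc i) (λ k → mnv k j)) (λ j → Σ< (suc i) (mn j) * v j)
           (λ j _ → trans
             (Σ<-cong (suc i) (λ k → mnv k j) (λ k → mn j k * v j)
               (λ k _ → sym (*-assoc (m i k) (n k j) (v j))))
             (sym (*-distribʳ-sum {suc i} (v j) (λ k → mn j (toℕ k))))) ⟩
    Σ< (suc i) (λ j → Σ< (suc i) (mn j) * v j)
      ≈⟨ Σ<-cong (suc i) (λ j → Σ< (suc i) (mn j) * v j) (λ j → unit j i * v j)
           (λ j _ → *-congʳ (⁻¹-inverse-entry M j i)) ⟩
    Σ< (suc i) (λ j → unit j i * v j)
      ≈⟨ Σ<-last i (λ j → unit j i * v j)
           (λ j j<i → trans (*-congʳ (unit-lower j<i)) (zeroˡ (v j))) ⟩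
    unit i i * v i
      ≈⟨ trans (*-congʳ (unit-diag i)) (*-identityˡ (v i)) ⟩
    v i ∎
    where
    m n nv mnv mn : Matrix
    m = entry M
    n = entry (M ⁻¹)
    nv k j  = n k j * v j
    mnv k j = m i k * nv k j
    mn j k  = m i k * n k j

  ·-injective : ∀ M {v w} → M · v ≋ M · w → v ≋ w
  ·-injective M {v} {w} p = <-rec _ λ i rec →
    let f : Series
        f k = entry M i k * v k
        g : Series
        g k = entry M i k * w k
        m = entry M i i
        d = inv m (diagonal M i)
        f≈g : m * v i ≈ m * w i
        f≈g = begin
          m * v i                        ≈⟨ strip (Σ< i f) _ ⟨
          - Σ< i f + (Σ< i f + m * v i)  ≈⟨ +-cong (-‿cong (Σ<-cong i f g (λ k k<i → *-congˡ (rec k<i))))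
                                              (trans (sym (Σ<-suc i f)) (trans (p i) (Σ<-suc i g))) ⟩
          - Σ< i g + (Σ< i g + m * w i)  ≈⟨ strip (Σ< i g) _ ⟩
          m * w i                        ∎
    in trans (sym (cancel i (v i))) (trans (*-congˡ f≈g) (cancel i (w i)))
    where
    strip : ∀ x y → - x + (x + y) ≈ y
    strip x y = trans (sym (+-assoc _ _ _)) (trans (+-congʳ (-‿inverseˡ x)) (+-identityˡ y))
    cancel : ∀ i x → inv (entry M i i) (diagonal M i) * (entry M i i * x) ≈ x
    cancel i x = trans (sym (*-assoc _ _ _))
      (trans (*-congʳ (inv-inverseˡ _ (diagonal M i))) (*-identityˡ x))

  ⁻¹-inverseˡ : ∀ M v → M ⁻¹ · M · v ≋ v
  ⁻¹-inverseˡ M v = ·-injective M (⁻¹-inverseʳ M (M · v))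

  record NonzeroConstant (g : Series) : Set ℓ₂ where
    field g₀#0 : g 0 # 0#

  open NonzeroConstant {{...}} public

  -- Division by h is forward substitution for the matrix of v ↦ h ⊗ v.
  infixl 7 _⊘_
  _⊘_ : (a h : Series) → {{NonzeroConstant h}} → Series
  a ⊘ h = solve (λ i j → h (i ∸ j)) (λ _ → inv (h 0) g₀#0) a

  ⊘-correct : ∀ a h {{_ : NonzeroConstant h}} → h ⊗ (a ⊘ h) ≋ a
  ⊘-correct a h = apply-solve (λ i j → h (i ∸ j)) (λ _ → inv (h 0) g₀#0) a
    (λ i → trans (*-congʳ (reflexive (≡.cong h (ℕ.n∸n≡0 i)))) (inv-inverseʳ (h 0) g₀#0))

  -- The square root with constant term 1 of a series a with constant term 1:
  -- s₀ = 1 and 2sₙ₊₁ = aₙ₊₁ - (s₁sₙ + s₂sₙ₋₁ + ⋯ + sₙs₁).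
  sqrtStep : Series → Series → Series
  sqrtStep a s zero    = 1#
  sqrtStep a s (suc n) = ½ * (a (suc n) - ∑[ k < n ] (s (n ∸ toℕ k) * s (suc (toℕ k))))

  √_ : Series → Series
  √ a = fix (sqrtStep a)

  infix 8 √_

  2½ : ∀ x → ½ * x + ½ * x ≈ x
  2½ x = begin
    ½ * x + ½ * x        ≈⟨ distribʳ x ½ ½ ⟨
    (½ + ½) * x          ≈⟨ *-congʳ (+-cong (*-identityʳ ½) (*-identityʳ ½)) ⟨
    (½ * 1# + ½ * 1#) * x ≈⟨ *-congʳ (distribˡ ½ 1# 1#) ⟨
    (½ * (1# + 1#)) * x  ≈⟨ *-congʳ (inv-inverseˡ _ 2#0) ⟩
    1# * x               ≈⟨ *-identityˡ x ⟩
    x                    ∎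

  sqrt-causal : ∀ a → Causal (sqrtStep a)
  sqrt-causal a zero    p = refl
  sqrt-causal a {s} {t} (suc n) p = *-congˡ (+-congˡ (-‿cong (Σ<-cong n
    (λ k → s (n ∸ k) * s (suc k)) (λ k → t (n ∸ k) * t (suc k)) (λ k k<n →
    *-cong (p (n ∸ k) (s≤s (ℕ.m∸n≤m n k))) (p (suc k) (s≤s k<n))))))

  √-correct : ∀ a → a 0 ≈ 1# → √ a ⊗ √ a ≋ a
  √-correct a a₀≈1 zero = begin
    1# * 1# + 0# ≈⟨ +-identityʳ _ ⟩
    1# * 1#      ≈⟨ *-identityˡ 1# ⟩
    1#           ≈⟨ a₀≈1 ⟨
    a 0          ∎
  √-correct a a₀≈1 (suc n) = begin
    s (suc n) * 1# + Σ< (suc n) f          ≈⟨ +-cong (*-identityʳ _) (Σ<-suc n f) ⟩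
    s (suc n) + (Σ< n f + s (n ∸ n) * s (suc n))
      ≈⟨ +-congˡ (+-congˡ (trans (*-congʳ (reflexive (≡.cong s (ℕ.n∸n≡0 n)))) (*-identityˡ _))) ⟩
    s (suc n) + (Σ< n f + s (suc n))       ≈⟨ +-congˡ (+-comm _ _) ⟩
    s (suc n) + (s (suc n) + Σ< n f)       ≈⟨ +-assoc _ _ _ ⟨
    s (suc n) + s (suc n) + Σ< n f         ≈⟨ +-congʳ (+-cong unfold unfold) ⟩
    ½ * w + ½ * w + Σ< n f                 ≈⟨ +-congʳ (2½ w) ⟩
    (a (suc n) - Σ< n f) + Σ< n f          ≈⟨ x-x+y _ _ ⟩
    a (suc n)                              ∎
    where
    s = √ a
    f : Series
    f k = s (n ∸ k) * s (suc k)
    w = a (suc n) - Σ< n f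
    unfold : s (suc n) ≈ ½ * w
    unfold = fix-unfold (sqrt-causal a) (suc n)

  -- Division by 2x of a series with constant term 0.
  infixl 7 _/2X
  _/2X : Series → Series
  (a /2X) n = ½ * a (suc n)

  κ⊗ : ∀ m b → κ m ⊗ b ≋ λ n → (m × 1#) * b n
  κ⊗ m b n = trans
    (Σ<-last n (λ k → κ m (n ∸ k) * b k) (λ k k<n → trans (*-congʳ (κ-suc (n ∸ k) (ℕ.m<n⇒0<n∸m k<n))) (zeroˡ _)))
    (*-congʳ (reflexive (≡.cong (κ m) (ℕ.n∸n≡0 n))))
    where
    κ-suc : ∀ j → 0 < j → κ m j ≈ 0#
    κ-suc (suc j) _ = refl

  ⊗₀ : ∀ a b → (a ⊗ b) 0 ≈ a 0 * b 0
  ⊗₀ a b = +-identityʳ _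

  linear⊗ : ∀ a b → a 0 ≈ 0# → (∀ n → a (suc (suc n)) ≈ 0#) →
            ∀ n → (a ⊗ b) (suc n) ≈ a 1 * b n
  linear⊗ a b a₀ a₂ n = begin
    Σ< (suc (suc n)) f                ≈⟨ Σ<-suc (suc n) f ⟩
    Σ< (suc n) f + a (n ∸ n) * b (suc n)
      ≈⟨ +-congˡ (trans (*-congʳ (trans (reflexive (≡.cong a (ℕ.n∸n≡0 n))) a₀)) (zeroˡ _)) ⟩
    Σ< (suc n) f + 0#                 ≈⟨ +-identityʳ _ ⟩
    Σ< (suc n) f                      ≈⟨ Σ<-last n f (λ k k<n → trans (*-congʳ (low k k<n)) (zeroˡ _)) ⟩
    a (suc n ∸ n) * b n               ≈⟨ *-congʳ (reflexive (≡.cong a (ℕ.m+n∸n≡m 1 n))) ⟩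
    a 1 * b n                         ∎
    where
    f : Series
    f k = a (suc n ∸ k) * b k
    low : ∀ k → k < n → a (suc n ∸ k) ≈ 0#
    low k k<n with suc n ∸ k | ℕ.m+n≤o⇒m≤o∸n 2 (s≤s k<n)
    ... | suc zero    | s≤s ()
    ... | suc (suc j) | _ = a₂ j

  κX-1 : ∀ m → (κ m ⊗ X) 1 ≈ m × 1#
  κX-1 m = trans (κ⊗ m X 1) (*-identityʳ _)

  κX⊗ : ∀ m b n → (κ m ⊗ X ⊗ b) (suc n) ≈ (m × 1#) * b n
  κX⊗ m b n = trans
    (linear⊗ (κ m ⊗ X) b (trans (κ⊗ m X 0) (zeroʳ _)) (λ n → trans (κ⊗ m X (suc (suc n))) (zeroʳ _)) n)
    (*-congʳ (κX-1 m))

  κX⊗₀ : ∀ m b → (κ m ⊗ X ⊗ b) 0 ≈ 0#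
  κX⊗₀ m b = trans (⊗₀ (κ m ⊗ X) b)
    (trans (*-congʳ (trans (κ⊗ m X 0) (zeroʳ _))) (zeroˡ _))

  X⊗ : ∀ b n → (X ⊗ b) (suc n) ≈ b n
  X⊗ b n = trans (linear⊗ X b refl (λ _ → refl) n) (*-identityˡ _)

  X⊗₀ : ∀ b → (X ⊗ b) 0 ≈ 0#
  X⊗₀ b = trans (⊗₀ X b) (zeroˡ _)

  /2X-correct : ∀ a → a 0 ≈ 0# → κ 2 ⊗ X ⊗ (a /2X) ≋ a
  /2X-correct a a₀≈0 zero    = trans (κX⊗₀ 2 (a /2X)) (sym a₀≈0)
  /2X-correct a a₀≈0 (suc n) = begin
    (κ 2 ⊗ X ⊗ (a /2X)) (suc n)         ≈⟨ κX⊗ 2 (a /2X) n ⟩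
    (1# + (1# + 0#)) * (½ * a (suc n))  ≈⟨ *-congʳ (+-congˡ (+-identityʳ 1#)) ⟩
    (1# + 1#) * (½ * a (suc n))         ≈⟨ *-assoc _ _ _ ⟨
    (1# + 1#) * ½ * a (suc n)           ≈⟨ *-congʳ (inv-inverseʳ _ 2#0) ⟩
    1# * a (suc n)                      ≈⟨ *-identityˡ _ ⟩
    a (suc n)                           ∎

  C : Series
  C = (𝟙 ⊖ √ (𝟙 ⊖ κ 4 ⊗ X)) /2X

  record Delta (f : Series) : Set (ℓ₁ ⊔ ℓ₂) where
    field
      f₀≈0 : f 0 ≈ 0#
      f₁#0 : f 1 # 0#

  open Delta {{...}} public

  ⊗-low : ∀ a b j → (∀ k → k < j → b k ≈ 0#) → ∀ i → i < j → (a ⊗ b) i ≈ 0#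
  ⊗-low a b j p i i<j = Σ<-zero (suc i) (λ k → a (i ∸ k) * b k) (λ k k≤i →
    trans (*-congˡ (p k (ℕ.<-≤-trans k≤i i<j))) (zeroʳ _))

  ⊗-lead : ∀ a b j → (∀ k → k < j → b k ≈ 0#) → (a ⊗ b) j ≈ a 0 * b j
  ⊗-lead a b j p = trans
    (Σ<-last j (λ k → a (j ∸ k) * b k) (λ k k<j → trans (*-congˡ (p k k<j)) (zeroʳ _)))
    (*-congʳ (reflexive (≡.cong a (ℕ.n∸n≡0 j))))

  module _ (f : Series) {{δ : Delta f}} where

    ^-low : ∀ j i → i < j → (f ^ j) i ≈ 0#
    ^-low (suc j) i (s≤s i≤j) = Σ<-zero (suc i) (λ k → f (i ∸ k) * (f ^ j) k) term
      where
      term : ∀ k → k < suc i → f (i ∸ k) * (f ^ j) k ≈ 0#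
      term k (s≤s k≤i) with ℕ.m≤n⇒m<n∨m≡n (ℕ.≤-trans k≤i i≤j)
      ... | inj₁ k<j    = trans (*-congˡ (^-low j k k<j)) (zeroʳ _)
      ... | inj₂ ≡.refl = trans (*-congʳ
        (trans (reflexive (≡.cong f (ℕ.m≤n⇒m∸n≡0 i≤j))) f₀≈0)) (zeroˡ _)

    ^-lead : ∀ j → (f ^ j) j # 0#
    ^-lead zero    = 1#0
    ^-lead (suc j) = #-congʳ (sym eq) (x#0y#0→xy#0 f₁#0 (^-lead j))
      where
      eq : (f ^ suc j) (suc j) ≈ f 1 * (f ^ j) j
      eq = begin
        Σ< (suc (suc j)) g            ≈⟨ Σ<-suc (suc j) g ⟩
        Σ< (suc j) g + f (j ∸ j) * (f ^ j) (suc j)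
          ≈⟨ +-congˡ (trans (*-congʳ (trans (reflexive (≡.cong f (ℕ.n∸n≡0 j))) f₀≈0)) (zeroˡ _)) ⟩
        Σ< (suc j) g + 0#             ≈⟨ +-identityʳ _ ⟩
        Σ< (suc j) g                  ≈⟨ Σ<-last j g (λ k k<j → trans (*-congˡ (^-low j k k<j)) (zeroʳ _)) ⟩
        f (suc j ∸ j) * (f ^ j) j     ≈⟨ *-congʳ (reflexive (≡.cong f (ℕ.m+n∸n≡m 1 j))) ⟩
        f 1 * (f ^ j) j               ∎
        where
        g : Series
        g k = f (suc j ∸ k) * (f ^ j) k

  ⟪_,_⟫ : (g f : Series) → {{NonzeroConstant g}} → {{Delta f}} → LowerTriangular
  ⟪ g , f ⟫ = record
    { entry    = λ i j → (g ⊗ f ^ j) i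
    ; upper≈0  = λ i j → ⊗-low g (f ^ j) j (^-low f j) i
    ; diagonal = λ i → #-congʳ (sym (⊗-lead g (f ^ i) i (^-low f i)))
                         (x#0y#0→xy#0 g₀#0 (^-lead f i))
    }

  1₀ : ∀ {g} → g 0 ≈ 1# → NonzeroConstant g
  1₀ p = record { g₀#0 = #-congʳ (sym p) 1#0 }

  1+0 : ∀ {x} → x ≈ 0# → 1# + x ≈ 1#
  1+0 p = trans (+-congˡ p) (+-identityʳ 1#)

  1-0 : ∀ {x} → x ≈ 0# → 1# - x ≈ 1#
  1-0 p = trans (+-congˡ (-‿cong p)) (x-0≈x 1#)

  ⊘-const : ∀ a h {{α : NonzeroConstant a}} {{η : NonzeroConstant h}} → NonzeroConstant (a ⊘ h)
  ⊘-const a h {{α}} {{η}} = record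
    { g₀#0 = x#0y#0→xy#0 (inv#0 (h 0) (NonzeroConstant.g₀#0 η))
               (#-congʳ (sym (x-0≈x _)) (NonzeroConstant.g₀#0 α)) }

  4X²C²₀ : (κ 4 ⊗ X ^ 2 ⊗ C ^ 2) 0 ≈ 0#
  4X²C²₀ = trans (⊗₀ (κ 4 ⊗ X ^ 2) (C ^ 2)) (trans (*-congʳ
    (trans (κ⊗ 4 (X ^ 2) 0) (trans (*-congˡ (X⊗₀ (X ^ 1))) (zeroʳ _)))) (zeroˡ _))

  C₀≈1 : C 0 ≈ 1#
  C₀≈1 = begin
    ½ * (0# - ½ * ((0# - (κ 4 ⊗ X) 1) - 0#)) ≈⟨ *-congˡ (+-identityˡ _) ⟩
    ½ * - (½ * ((0# - (κ 4 ⊗ X) 1) - 0#))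
      ≈⟨ *-congˡ (-‿cong (*-congˡ (trans (x-0≈x _) (+-identityˡ _)))) ⟩
    ½ * - (½ * - (κ 4 ⊗ X) 1)     ≈⟨ *-congˡ (-‿distribʳ-* _ _) ⟩
    ½ * (½ * - - (κ 4 ⊗ X) 1)     ≈⟨ *-congˡ (*-congˡ (trans (-‿involutive _) (κX-1 4))) ⟩
    ½ * (½ * (1# + (1# + (1# + (1# + 0#)))))
      ≈⟨ *-congˡ (*-congˡ (trans (sym (+-assoc _ _ _)) (+-congˡ (+-congˡ (+-identityʳ 1#))))) ⟩
    ½ * (½ * ((1# + 1#) + (1# + 1#)))   ≈⟨ *-congˡ (trans (distribˡ _ _ _) (2½ _)) ⟩
    ½ * (1# + 1#)                       ≈⟨ inv-inverseˡ _ 2#0 ⟩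
    1#                                  ∎

  instance
    𝟙-nonzero : NonzeroConstant 𝟙
    𝟙-nonzero = 1₀ refl

    1+2X-nonzero : NonzeroConstant (𝟙 ⊕ κ 2 ⊗ X)
    1+2X-nonzero = 1₀ (1+0 (trans (κ⊗ 2 X 0) (zeroʳ _)))

    1+2XC-nonzero : NonzeroConstant (𝟙 ⊕ κ 2 ⊗ X ⊗ C)
    1+2XC-nonzero = 1₀ (1+0 (κX⊗₀ 2 C))

    1-2XC-nonzero : NonzeroConstant (𝟙 ⊖ κ 2 ⊗ X ⊗ C)
    1-2XC-nonzero = 1₀ (1-0 (κX⊗₀ 2 C))

    1-4X²C²-nonzero : NonzeroConstant (𝟙 ⊖ κ 4 ⊗ X ^ 2 ⊗ C ^ 2)
    1-4X²C²-nonzero = 1₀ (1-0 4X²C²₀)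

    1/[1+2XC]-nonzero : NonzeroConstant (𝟙 ⊘ (𝟙 ⊕ κ 2 ⊗ X ⊗ C))
    1/[1+2XC]-nonzero = ⊘-const 𝟙 (𝟙 ⊕ κ 2 ⊗ X ⊗ C)

    1/[1-4X²C²]-nonzero : NonzeroConstant (𝟙 ⊘ (𝟙 ⊖ κ 4 ⊗ X ^ 2 ⊗ C ^ 2))
    1/[1-4X²C²]-nonzero = ⊘-const 𝟙 (𝟙 ⊖ κ 4 ⊗ X ^ 2 ⊗ C ^ 2)

    [1+2XC]/[1-2XC]-nonzero : NonzeroConstant ((𝟙 ⊕ κ 2 ⊗ X ⊗ C) ⊘ (𝟙 ⊖ κ 2 ⊗ X ⊗ C))
    [1+2XC]/[1-2XC]-nonzero = ⊘-const (𝟙 ⊕ κ 2 ⊗ X ⊗ C) (𝟙 ⊖ κ 2 ⊗ X ⊗ C)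

    X[1+X]-delta : Delta (X ⊗ (𝟙 ⊕ X))
    X[1+X]-delta = record
      { f₀≈0 = X⊗₀ (𝟙 ⊕ X)
      ; f₁#0 = #-congʳ (sym (trans (X⊗ (𝟙 ⊕ X) 0) (+-identityʳ 1#))) 1#0 }

    -X-delta : Delta (⊝ X)
    -X-delta = record
      { f₀≈0 = -0#≈0#
      ; f₁#0 = invertibleʳ⇒# (- 1# , trans (*-congʳ (x-0≈x _))
          (trans (sym (-‿distribʳ-* _ _)) (trans (-‿cong (*-identityʳ _)) (-‿involutive 1#)))) }

    XC-delta : Delta (X ⊗ C)
    XC-delta = record
      { f₀≈0 = X⊗₀ C
      ; f₁#0 = #-congʳ (sym (trans (X⊗ C 0) C₀≈1)) 1#0 }

  Fˢ Lˢ D : LowerTriangular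
  Fˢ = ⟪ 𝟙 , X ⊗ (𝟙 ⊕ X) ⟫
  Lˢ = ⟪ 𝟙 ⊕ κ 2 ⊗ X , X ⊗ (𝟙 ⊕ X) ⟫
  D  = ⟪ 𝟙 , ⊝ X ⟫

{-# OPTIONS --safe #-}
module Submission where

-- With u ∘ f the series u(f(x)), the matrix ⟪ g , f ⟫ acts by u ↦ g ⊗ (u ∘ f), and
-- substitution is associative and multiplicative.  The series W = xC(x) satisfies
-- W - W² = x, so W is a right inverse of x(1-x), the composite of -x, x(1+x), -x;
-- hence D Fˢ⁻¹ D u = u ∘ W and (1 - 2W) (D Lˢ⁻¹ D u) = u ∘ W.  As z = (1+2x) y, also
-- z ∘ W = (1 + 2W) (y ∘ W), and (a)-(d) follow by cancelling denominators.

open import Algebra.Bundles using (CommutativeRing)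
open import Algebra.Apartness.Bundles using (HeytingField; HeytingCommutativeRing)
import Algebra.Apartness.Properties.HeytingCommutativeRing as HeytingProperties
import Algebra.Construct.Pointwise as Pointwise
import Algebra.Properties.AbelianGroup as AbelianGroupProperties
import Algebra.Properties.CommutativeSemigroup as CommutativeSemigroupProperties
import Algebra.Properties.Ring as RingProperties
import Algebra.Properties.Semiring.Mult as SemiringMult
import Algebra.Properties.Semiring.Sum as SemiringSum
import Algebra.Solver.Ring.NaturalCoefficients.Default as SemiringSolver
open import Data.Fin.Base using (toℕ)
open import Data.Nat.Base using (ℕ; zero; suc; _∸_; _<_; s≤s)
open import Data.Nat.Induction using (<-rec)
import Data.Nat.Properties as ℕ
open import Data.Product.Base using (_×_; _,_)
open import Data.Sum.Base using (inj₁; inj₂)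
open import Relation.Binary.PropositionalEquality.Core as ≡ using ()
import Relation.Binary.Reasoning.Setoid as SetoidReasoning
open import Defs

-- Identities in a commutative ring.

module CommutativeRingIdentities {c ℓ} (R : CommutativeRing c ℓ) where

  open CommutativeRing R
  open RingProperties ring
  open SetoidReasoning setoid
  open SemiringSolver commutativeSemiring using (solve; _:=_; _:+_; _:*_)

  cancelˡ : ∀ h h′ x y → h * h′ ≈ 1# → h * x ≈ h * y → x ≈ y
  cancelˡ h h′ x y hh′≈1 hx≈hy = begin
    x              ≈⟨ expand x ⟩
    h′ * (h * x)   ≈⟨ *-congˡ hx≈hy ⟩
    h′ * (h * y)   ≈⟨ expand y ⟨
    y              ∎
    where
    expand : ∀ z → z ≈ h′ * (h * z)
    expand z = begin
      z              ≈⟨ *-identityˡ z ⟨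
      1# * z         ≈⟨ *-congʳ hh′≈1 ⟨
      h * h′ * z     ≈⟨ *-congʳ (*-comm h h′) ⟩
      h′ * h * z     ≈⟨ *-assoc h′ h z ⟩
      h′ * (h * z)   ∎

  -- Carries the Horner factor `x` into both terms of a product rule; used in the inductive step of
  -- `∘-⊗`.
  x[yz+uv]≈xyz+uxv : ∀ x y z u v → x * (y * z + u * v) ≈ x * y * z + u * (x * v)
  x[yz+uv]≈xyz+uxv = solve 5 (λ x y z u v →
    x :* (y :* z :+ u :* v) := x :* y :* z :+ u :* (x :* v)) refl

  -- The products xx1, yy1 are the normal forms of the powers x ^ 2, y ^ 2.
  [txy][txy]≈ttx²y² : ∀ t x y →
    (t * x * y) * (t * x * y) ≈ t * t * (x * (x * 1#)) * (y * (y * 1#))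
  [txy][txy]≈ttx²y² t x y = trans
    (solve 3 (λ t x y → (t :* x :* y) :* (t :* x :* y) := t :* t :* (x :* x) :* (y :* y)) refl t x y)
    (sym (*-cong (*-congˡ (*-congˡ (*-identityʳ x))) (*-congˡ (*-identityʳ y))))

  [1-x][1+x]≈1-xx : ∀ x → (1# - x) * (1# + x) ≈ 1# - x * x
  [1-x][1+x]≈1-xx x = begin
    (1# - x) * (1# + x)            ≈⟨ distribˡ _ 1# x ⟩
    (1# - x) * 1# + (1# - x) * x   ≈⟨ +-cong (*-identityʳ _) (trans ([y-z]x≈yx-zx x 1# x) (+-congʳ (*-identityˡ x))) ⟩
    (1# - x) + (x - x * x)         ≈⟨ +-assoc 1# (- x) _ ⟩
    1# + (- x + (x - x * x))       ≈⟨ +-congˡ (+-assoc (- x) x _) ⟨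
    1# + ((- x + x) - x * x)       ≈⟨ +-congˡ (trans (+-congʳ (-‿inverseˡ x)) (+-identityˡ _)) ⟩
    1# - x * x                     ∎

  -- The composite of -x, x(1+x) and -x, evaluated at `y`, is y - y². With `y` = xC(x) this exhibits
  -- xC(x) as a right inverse of that composite.
  yy+x≈y⇒-[-y[1-y]]≈x : ∀ x y → y * y + x ≈ y → - (- y * (1# + - y)) ≈ x
  yy+x≈y⇒-[-y[1-y]]≈x x y p = begin
    - (- y * (1# - y))        ≈⟨ -‿cong (-‿distribˡ-* y (1# - y)) ⟨
    - - (y * (1# - y))        ≈⟨ -‿involutive _ ⟩
    y * (1# - y)              ≈⟨ x[y-z]≈xy-xz y 1# y ⟩
    y * 1# - y * y            ≈⟨ +-congʳ (*-identityʳ y) ⟩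
    y - y * y                 ≈⟨ +-congʳ p ⟨
    (y * y + x) - y * y       ≈⟨ +-congʳ (+-comm (y * y) x) ⟩
    (x + y * y) - y * y       ≈⟨ +-assoc x _ _ ⟩
    x + (y * y - y * y)       ≈⟨ +-congˡ (-‿inverseʳ (y * y)) ⟩
    x + 0#                    ≈⟨ +-identityʳ x ⟩
    x                         ∎

  -- Expand (w + s)² and cancel s².
  w+s≈1∧ss+k≈1⇒ww+k≈w+w : ∀ w s k → w + s ≈ 1# → s * s + k ≈ 1# → w * w + k ≈ w + w
  w+s≈1∧ss+k≈1⇒ww+k≈w+w w s k p q = +-cancelʳ (s * s) _ _ (begin
    w * w + k + s * s               ≈⟨ solve 3 (λ w s k → w :* w :+ k :+ s :* s := w :* w :+ (s :* s :+ k)) refl w s k ⟩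
    w * w + (s * s + k)             ≈⟨ +-congˡ (trans q (sym (trans (*-cong p p) (*-identityˡ 1#)))) ⟩
    w * w + (w + s) * (w + s)       ≈⟨ solve 2 (λ w s → w :* w :+ (w :+ s) :* (w :+ s) := (w :+ w) :* (w :+ s) :+ s :* s) refl w s ⟩
    (w + w) * (w + s) + s * s       ≈⟨ +-congʳ (trans (*-congˡ p) (*-identityʳ _)) ⟩
    w + w + s * s                   ∎)

  -- The case w = 2y, k = 4x of the conclusion above, with t = 2 so that t t can be cancelled later.
  ww+k≈w+w⇒4[yy+x]≈4y : ∀ t x y → t ≈ 1# + 1# →
    (t * y) * (t * y) + (t * t) * x ≈ t * y + t * y → t * (t * (y * y + x)) ≈ t * (t * y)
  ww+k≈w+w⇒4[yy+x]≈4y t x y t≈2 p = begin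
    t * (t * (y * y + x))                       ≈⟨ solve 3 (λ t x y → t :* (t :* (y :* y :+ x)) := (t :* y) :* (t :* y) :+ (t :* t) :* x) refl t x y ⟩
    (t * y) * (t * y) + (t * t) * x             ≈⟨ p ⟩
    t * y + t * y                               ≈⟨ +-cong (*-identityˡ _) (*-identityˡ _) ⟨
    1# * (t * y) + 1# * (t * y)                 ≈⟨ distribʳ _ 1# 1# ⟨
    (1# + 1#) * (t * y)                         ≈⟨ *-congʳ t≈2 ⟨
    t * (t * y)                                 ∎

module SeriesComposition {c ℓ₁ ℓ₂} (K : HeytingField c ℓ₁ ℓ₂) (2#0 : TwoNonzero K) where

  open HeytingField K
  open HeytingCommutativeRing heytingCommutativeRing using (commutativeRing)
  open CommutativeRing commutativeRing using (semiring; +-abelianGroup; +-commutativeSemigroup)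
  open CommutativeSemigroupProperties +-commutativeSemigroup using (x∙yz≈y∙xz)
  open AbelianGroupProperties +-abelianGroup using (inverseʳ-unique)
  open SemiringSum semiring
  open RiordanMatrices K 2#0
  open ≈-Reasoning

  -- Linearity and associativity of matrix application.

  LowTriangular : Matrix → Set ℓ₁
  LowTriangular m = ∀ i j → i < j → m i j ≈ 0#

  apply-cong : ∀ m {v w} → v ≋ w → apply m v ≋ apply m w
  apply-cong m {v} {w} v≋w i =
    Σ<-cong (suc i) (λ k → m i k * v k) (λ k → m i k * w k) (λ k _ → *-congˡ (v≋w k))

  apply-congˡ : ∀ {m n : Matrix} v → (∀ i j → m i j ≈ n i j) → apply m v ≋ apply n v
  apply-congˡ {m} {n} v m≋n i =
    Σ<-cong (suc i) (λ k → m i k * v k) (λ k → n i k * v k) (λ k _ → *-congʳ (m≋n i k))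

  apply-𝟘 : ∀ m → apply m 𝟘 ≋ 𝟘
  apply-𝟘 m i = Σ<-zero (suc i) (λ k → m i k * 0#) (λ k _ → zeroʳ _)

  apply-⊕ : ∀ m v w → apply m (v ⊕ w) ≋ apply m v ⊕ apply m w
  apply-⊕ m v w i = trans
    (Σ<-cong (suc i) (λ k → m i k * (v k + w k)) (λ k → m i k * v k + m i k * w k)
      (λ k _ → distribˡ (m i k) (v k) (w k)))
    (∑-distrib-+ {suc i} (λ k → m i (toℕ k) * v (toℕ k)) (λ k → m i (toℕ k) * w (toℕ k)))

  apply-⊝ : ∀ m v → apply m (⊝ v) ≋ ⊝ apply m v
  apply-⊝ m v i = inverseʳ-unique (apply m v i) (apply m (⊝ v) i) (begin
    apply m v i + apply m (⊝ v) i   ≈⟨ apply-⊕ m v (⊝ v) i ⟨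
    apply m (v ⊕ ⊝ v) i             ≈⟨ apply-cong m (λ k → -‿inverseʳ (v k)) i ⟩
    apply m 𝟘 i                     ≈⟨ apply-𝟘 m i ⟩
    0#                              ∎)

  apply-*ʳ : ∀ m v x → apply m (λ k → v k * x) ≋ λ i → apply m v i * x
  apply-*ʳ m v x i = trans
    (Σ<-cong (suc i) (λ k → m i k * (v k * x)) (λ k → m i k * v k * x)
      (λ k _ → sym (*-assoc (m i k) (v k) x)))
    (sym (*-distribʳ-sum {suc i} x (λ k → m i (toℕ k) * v (toℕ k))))

  -- Since `n` vanishes above the diagonal, every inner sum extends to the common range up to `i`,
  -- after which the two sums can be exchanged.
  apply-apply : ∀ m {n} v → LowTriangular n →
                apply m (apply n v) ≋ apply (λ i j → apply m (λ k → n k j) i) v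
  apply-apply m {n} v n-low i = begin
    Σ< (suc i) (λ k → m i k * Σ< (suc k) (nv k))
      ≈⟨ Σ<-cong (suc i) (λ k → m i k * Σ< (suc k) (nv k)) (λ k → m i k * Σ< (suc i) (nv k))
           (λ k k≤i → *-congˡ (sym (Σ<-extend (nv k) k≤i (λ j k<j _ →
             trans (*-congʳ (n-low k j k<j)) (zeroˡ (v j)))))) ⟩
    Σ< (suc i) (λ k → m i k * Σ< (suc i) (nv k))
      ≈⟨ Σ<-cong (suc i) (λ k → m i k * Σ< (suc i) (nv k)) (λ k → Σ< (suc i) (mnv k))
           (λ k _ → *-distribˡ-sum {suc i} (m i k) (λ j → nv k (toℕ j))) ⟩
    Σ< (suc i) (λ k → Σ< (suc i) (mnv k))
      ≈⟨ ∑-comm {suc i} {suc i} (λ k j → mnv (toℕ k) (toℕ j)) ⟩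
    Σ< (suc i) (λ j → Σ< (suc i) (λ k → mnv k j))
      ≈⟨ Σ<-cong (suc i) (λ j → Σ< (suc i) (λ k → mnv k j)) (λ j → Σ< (suc i) (mn j) * v j)
           (λ j _ → apply-*ʳ m (λ k → n k j) (v j) i) ⟩
    Σ< (suc i) (λ j → Σ< (suc i) (mn j) * v j) ∎
    where
    nv mnv mn : Matrix
    nv k j  = n k j * v j
    mnv k j = m i k * nv k j
    mn j k  = m i k * n k j

  -- The commutative ring of power series.

  tail : Series → Series
  tail a n = a (suc n)

  ⊗-cong : ∀ {a a′ b b′} → a ≋ a′ → b ≋ b′ → a ⊗ b ≋ a′ ⊗ b′
  ⊗-cong {a} {a′} {b} {b′} p q n = Σ<-cong (suc n)
    (λ k → a (n ∸ k) * b k) (λ k → a′ (n ∸ k) * b′ k) (λ k _ → *-cong (p (n ∸ k)) (q k))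

  -- The mirror image of `(a ⊗ b) (suc n) = a (suc n) * b 0 + (a ⊗ tail b) n`, which holds by
  -- computation because the sum runs over the index of `b`.
  ⊗-sucˡ : ∀ a b n → (a ⊗ b) (suc n) ≈ a 0 * b (suc n) + (tail a ⊗ b) n
  ⊗-sucˡ a b zero    = x∙yz≈y∙xz _ _ _
  ⊗-sucˡ a b (suc n) = trans (+-congˡ (⊗-sucˡ a (tail b) n)) (x∙yz≈y∙xz _ _ _)

  -- Induction on the index: the constant term of `b` splits off by computation on the left and by
  -- `⊗-sucˡ` on the right.
  ⊗-comm : ∀ a b → a ⊗ b ≋ b ⊗ a
  ⊗-comm a b zero    = +-congʳ (*-comm (a 0) (b 0))
  ⊗-comm a b (suc n) = trans (+-cong (*-comm (a (suc n)) (b 0)) (⊗-comm a (tail b) n))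
                             (sym (⊗-sucˡ b a n))

  -- Multiplication by `a` unfolds to the application of the Toeplitz matrix with entries
  -- `a (i ∸ j)`, so this and left distributivity are linearity of `apply`.
  ⊗-zeroʳ : ∀ a → a ⊗ 𝟘 ≋ 𝟘
  ⊗-zeroʳ a = apply-𝟘 (λ i j → a (i ∸ j))

  ⊗-distribˡ : ∀ a b c → a ⊗ (b ⊕ c) ≋ (a ⊗ b) ⊕ (a ⊗ c)
  ⊗-distribˡ a = apply-⊕ (λ i j → a (i ∸ j))

  ⊗-distribʳ : ∀ a b c → (b ⊕ c) ⊗ a ≋ (b ⊗ a) ⊕ (c ⊗ a)
  ⊗-distribʳ a b c n = trans (⊗-comm (b ⊕ c) a n)
    (trans (⊗-distribˡ a b c n) (+-cong (⊗-comm a b n) (⊗-comm a c n)))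

  ⊗-constʳ : ∀ a b → tail b ≋ 𝟘 → a ⊗ b ≋ λ n → a n * b 0
  ⊗-constʳ a b tb≋𝟘 zero    = +-identityʳ _
  ⊗-constʳ a b tb≋𝟘 (suc n) = trans
    (+-congˡ (trans (⊗-cong {a} {a} {tail b} {𝟘} (λ _ → refl) tb≋𝟘 n) (⊗-zeroʳ a n))) (+-identityʳ _)

  ⊗-identityʳ : ∀ a → a ⊗ 𝟙 ≋ a
  ⊗-identityʳ a n = trans (⊗-constʳ a 𝟙 (λ _ → refl) n) (*-identityʳ (a n))

  ⊗-identityˡ : ∀ a → 𝟙 ⊗ a ≋ a
  ⊗-identityˡ a n = trans (⊗-comm 𝟙 a n) (⊗-identityʳ a n)

  -- Induction on the index, peeling constant terms off `c`: `tail (b ⊗ c)` unfolds to `tail b`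
  -- scaled by `c 0`, plus `b ⊗ tail c`.
  ⊗-assoc : ∀ a b c → (a ⊗ b) ⊗ c ≋ a ⊗ (b ⊗ c)
  ⊗-assoc a b c zero = +-congʳ (begin
    (a 0 * b 0 + 0#) * c 0     ≈⟨ *-congʳ (+-identityʳ _) ⟩
    a 0 * b 0 * c 0            ≈⟨ *-assoc _ _ _ ⟩
    a 0 * (b 0 * c 0)          ≈⟨ *-congˡ (+-identityʳ _) ⟨
    a 0 * (b 0 * c 0 + 0#)     ∎)
  ⊗-assoc a b c (suc n) = begin
    (a (suc n) * b 0 + (a ⊗ tail b) n) * c 0 + ((a ⊗ b) ⊗ tail c) n
      ≈⟨ +-cong (distribʳ _ _ _) (⊗-assoc a b (tail c) n) ⟩
    a (suc n) * b 0 * c 0 + (a ⊗ tail b) n * c 0 + (a ⊗ (b ⊗ tail c)) n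
      ≈⟨ +-assoc _ _ _ ⟩
    a (suc n) * b 0 * c 0 + ((a ⊗ tail b) n * c 0 + (a ⊗ (b ⊗ tail c)) n)
      ≈⟨ +-cong (trans (*-assoc _ _ _) (*-congˡ (sym (⊗₀ b c)))) (sym a⊗tail[b⊗c]) ⟩
    a (suc n) * (b ⊗ c) 0 + (a ⊗ tail (b ⊗ c)) n ∎
    where
    a⊗tail[b⊗c] : (a ⊗ tail (b ⊗ c)) n ≈ (a ⊗ tail b) n * c 0 + (a ⊗ (b ⊗ tail c)) n
    a⊗tail[b⊗c] = trans (⊗-distribˡ a (λ k → tail b k * c 0) (b ⊗ tail c) n)
      (+-congʳ (apply-*ʳ (λ i j → a (i ∸ j)) (tail b) (c 0) n))

  seriesRing : CommutativeRing c ℓ₁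
  seriesRing = record
    { Carrier = Series ; _≈_ = _≋_ ; _+_ = _⊕_ ; _*_ = _⊗_ ; -_ = ⊝_ ; 0# = 𝟘 ; 1# = 𝟙
    ; isCommutativeRing = record
      { isRing = record
        { +-isAbelianGroup = Pointwise.isAbelianGroup ℕ (CommutativeRing.+-isAbelianGroup commutativeRing)
        ; *-cong     = λ {a} {a′} {b} {b′} → ⊗-cong {a} {a′} {b} {b′}
        ; *-assoc    = ⊗-assoc
        ; *-identity = ⊗-identityˡ , ⊗-identityʳ
        ; distrib    = ⊗-distribˡ , ⊗-distribʳ
        }
      ; *-comm = ⊗-comm
      }
    }

  open CommutativeRingIdentities seriesRing

  ⊗-cancelˡ : ∀ h {{_ : NonzeroConstant h}} a b → h ⊗ a ≋ h ⊗ b → a ≋ b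
  ⊗-cancelˡ h a b = cancelˡ h (𝟙 ⊘ h) a b (⊘-correct 𝟙 h)

  -- A factor without constant term raises degrees, so coefficient `n` of the product sees the other
  -- factor only below `n`. This lets inductions on the index pass through a multiplication by `f`.
  ⊗-causal : ∀ f a b → f 0 ≈ 0# → ∀ n → (∀ k → k < n → a k ≈ b k) → (f ⊗ a) n ≈ (f ⊗ b) n
  ⊗-causal f a b f₀≈0 n p =
    Σ<-cong (suc n) (λ k → f (n ∸ k) * a k) (λ k → f (n ∸ k) * b k) term
    where
    term : ∀ k → k < suc n → f (n ∸ k) * a k ≈ f (n ∸ k) * b k
    term k (s≤s k≤n) with ℕ.m≤n⇒m<n∨m≡n k≤n
    ... | inj₁ k<n    = *-congˡ (p k k<n)
    ... | inj₂ ≡.refl = trans (vanish (a n)) (sym (vanish (b n)))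
      where
      vanish : ∀ x → f (n ∸ n) * x ≈ 0#
      vanish x = trans (*-congʳ (trans (reflexive (≡.cong f (ℕ.n∸n≡0 n))) f₀≈0)) (zeroˡ x)

  -- Composition of power series.

  infixl 9 _∘_
  -- Coefficient `i` comes from the terms u_j f^j with j at most `i`; this is the substitution u(f)
  -- once `f 0 ≈ 0#`, when the omitted terms contribute zero.
  _∘_ : Series → Series → Series
  u ∘ f = apply (λ i j → (f ^ j) i) u

  -- Induction on the exponent: `f ^ j` agrees with `𝟘` below index `j`, hence by causality
  -- `f ^ suc j` agrees with `f ⊗ 𝟘` up to index `j`.
  ^-lowTriangular : ∀ f → f 0 ≈ 0# → LowTriangular (λ i j → (f ^ j) i)
  ^-lowTriangular f f₀≈0 i (suc j) (s≤s i≤j) = trans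
    (⊗-causal f (f ^ j) 𝟘 f₀≈0 i (λ k k<i → ^-lowTriangular f f₀≈0 k j (ℕ.<-≤-trans k<i i≤j)))
    (⊗-zeroʳ f i)

  ^-congˡ : ∀ {f g} → f ≋ g → ∀ j → f ^ j ≋ g ^ j
  ^-congˡ f≋g zero    _ = refl
  ^-congˡ {f} {g} f≋g (suc j) = ⊗-cong {f} {g} {f ^ j} {g ^ j} f≋g (^-congˡ f≋g j)

  ∘-congˡ : ∀ {u v} f → u ≋ v → u ∘ f ≋ v ∘ f
  ∘-congˡ f = apply-cong (λ i j → (f ^ j) i)

  ∘-congʳ : ∀ u {f g} → f ≋ g → u ∘ f ≋ u ∘ g
  ∘-congʳ u f≋g = apply-congˡ u (λ i j → ^-congˡ f≋g j i)

  ∘-zero : ∀ u f → (u ∘ f) 0 ≈ u 0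
  ∘-zero u f = trans (+-identityʳ _) (*-identityˡ (u 0))

  -- One step of Horner's scheme: u(f) = u₀ + f · (tail u)(f).
  ∘-suc : ∀ u f → f 0 ≈ 0# → ∀ n → (u ∘ f) (suc n) ≈ (f ⊗ (tail u ∘ f)) (suc n)
  ∘-suc u f f₀≈0 n = begin
    0# * u 0 + Σ< (suc n) g        ≈⟨ +-congʳ (zeroˡ (u 0)) ⟩
    0# + Σ< (suc n) g              ≈⟨ +-comm _ _ ⟩
    -- After the shift of the exponent the sum ends at `n`. The missing term `g (suc n)` contains
    -- coefficient `suc n` of `f ^ suc (suc n)`, which is zero.
    Σ< (suc n) g + 0#              ≈⟨ +-congˡ (trans (*-congʳ (^-lowTriangular f f₀≈0 _ _ (ℕ.n<1+n (suc n)))) (zeroˡ _)) ⟨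
    Σ< (suc n) g + g (suc n)       ≈⟨ Σ<-suc (suc n) g ⟨
    Σ< (suc (suc n)) g             ≈⟨ apply-apply (λ i j → f (i ∸ j)) (tail u) (^-lowTriangular f f₀≈0) (suc n) ⟨
    (f ⊗ (tail u ∘ f)) (suc n)     ∎
    where
    g : Series
    g k = (f ^ suc k) (suc n) * tail u k

  ∘-const : ∀ u f → f 0 ≈ 0# → tail u ≋ 𝟘 → u ∘ f ≋ u
  ∘-const u f f₀≈0 tu≋𝟘 zero    = ∘-zero u f
  ∘-const u f f₀≈0 tu≋𝟘 (suc n) = begin
    (u ∘ f) (suc n)              ≈⟨ ∘-suc u f f₀≈0 n ⟩
    (f ⊗ (tail u ∘ f)) (suc n)   ≈⟨ ⊗-cong {f} {f} {tail u ∘ f} {𝟘} (λ _ → refl) tu∘f≋𝟘 (suc n) ⟩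
    (f ⊗ 𝟘) (suc n)              ≈⟨ ⊗-zeroʳ f (suc n) ⟩
    0#                           ≈⟨ tu≋𝟘 n ⟨
    u (suc n)                    ∎
    where
    tu∘f≋𝟘 : tail u ∘ f ≋ 𝟘
    tu∘f≋𝟘 k = trans (∘-congˡ f tu≋𝟘 k) (apply-𝟘 (λ i j → (f ^ j) i) k)

  X-tail : tail X ≋ 𝟙
  X-tail zero    = refl
  X-tail (suc _) = refl

  X∘ : ∀ f → f 0 ≈ 0# → X ∘ f ≋ f
  X∘ f f₀≈0 zero    = trans (∘-zero X f) (sym f₀≈0)
  X∘ f f₀≈0 (suc n) = begin
    (X ∘ f) (suc n)              ≈⟨ ∘-suc X f f₀≈0 n ⟩
    (f ⊗ (tail X ∘ f)) (suc n)   ≈⟨ ⊗-cong {f} {f} {tail X ∘ f} {𝟙} (λ _ → refl) tX∘f≋𝟙 (suc n) ⟩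
    (f ⊗ 𝟙) (suc n)              ≈⟨ ⊗-identityʳ f (suc n) ⟩
    f (suc n)                    ∎
    where
    tX∘f≋𝟙 : tail X ∘ f ≋ 𝟙
    tX∘f≋𝟙 k = trans (∘-congˡ f X-tail k) (∘-const 𝟙 f f₀≈0 (λ _ → refl) k)

  ∘X : ∀ u → u ∘ X ≋ u
  ∘X u zero    = ∘-zero u X
  ∘X u (suc n) = trans (∘-suc u X refl n) (trans (X⊗ (tail u ∘ X) n) (∘X (tail u) n))

  ∘-⊕ : ∀ a b f → (a ⊕ b) ∘ f ≋ (a ∘ f) ⊕ (b ∘ f)
  ∘-⊕ a b f = apply-⊕ (λ i j → (f ^ j) i) a b

  ∘-⊝ : ∀ a f → (⊝ a) ∘ f ≋ ⊝ (a ∘ f)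
  ∘-⊝ a f = apply-⊝ (λ i j → (f ^ j) i) a

  -- Turns a scalar into a series, so that the product rule for `tail` can be rearranged inside
  -- `seriesRing`.
  constant : Carrier → Series
  constant x zero    = x
  constant x (suc _) = 0#

  -- Strong induction on the index, for all `b` at once because the step passes to `tail b`.
  -- Horner's step leaves `f` times the composite of `tail (a ⊗ b)`, and the factor `f` lowers the
  -- index so that the hypothesis applies.
  ∘-⊗ : ∀ a b f → f 0 ≈ 0# → (a ⊗ b) ∘ f ≋ (a ∘ f) ⊗ (b ∘ f)
  ∘-⊗ a b f f₀≈0 n = <-rec (λ n → ∀ b → ((a ⊗ b) ∘ f) n ≈ ((a ∘ f) ⊗ (b ∘ f)) n) step n b
    where
    a∘f a′∘f : Series
    a∘f  = a ∘ f
    a′∘f = tail a ∘ f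

    step : ∀ n → (∀ {k} → k < n → ∀ b → ((a ⊗ b) ∘ f) k ≈ ((a ∘ f) ⊗ (b ∘ f)) k) →
           ∀ b → ((a ⊗ b) ∘ f) n ≈ ((a ∘ f) ⊗ (b ∘ f)) n
    step zero _ b = begin
      ((a ⊗ b) ∘ f) 0            ≈⟨ ∘-zero (a ⊗ b) f ⟩
      a 0 * b 0 + 0#             ≈⟨ +-congʳ (*-cong (∘-zero a f) (∘-zero b f)) ⟨
      (a∘f ⊗ (b ∘ f)) 0          ∎
    step (suc n) rec b = begin
      ((a ⊗ b) ∘ f) (suc n)
        ≈⟨ ∘-suc (a ⊗ b) f f₀≈0 n ⟩
      (f ⊗ (tail (a ⊗ b) ∘ f)) (suc n)
        ≈⟨ ⊗-causal f (tail (a ⊗ b) ∘ f) ((a′∘f ⊗ b₀) ⊕ (a∘f ⊗ b′∘f)) f₀≈0 (suc n) tail-step ⟩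
      (f ⊗ ((a′∘f ⊗ b₀) ⊕ (a∘f ⊗ b′∘f))) (suc n)
        ≈⟨ x[yz+uv]≈xyz+uxv f a′∘f b₀ a∘f b′∘f (suc n) ⟩
      ((f ⊗ a′∘f) ⊗ b₀) (suc n) + (a∘f ⊗ (f ⊗ b′∘f)) (suc n)
        -- At positive indices `f ⊗ a′∘f` agrees with `a∘f`, and multiplication by a constant does
        -- not mix indices.
        ≈⟨ +-congʳ (trans (⊗-constʳ (f ⊗ a′∘f) b₀ (λ _ → refl) (suc n))
             (trans (*-congʳ (sym (∘-suc a f f₀≈0 n))) (sym (⊗-constʳ a∘f b₀ (λ _ → refl) (suc n))))) ⟩
      (a∘f ⊗ b₀) (suc n) + (a∘f ⊗ (f ⊗ b′∘f)) (suc n)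
        ≈⟨ ⊗-distribˡ a∘f b₀ (f ⊗ b′∘f) (suc n) ⟨
      (a∘f ⊗ (b₀ ⊕ (f ⊗ b′∘f))) (suc n)
        ≈⟨ ⊗-cong {a∘f} {a∘f} {b ∘ f} {b₀ ⊕ (f ⊗ b′∘f)} (λ _ → refl) b∘f (suc n) ⟨
      (a∘f ⊗ (b ∘ f)) (suc n) ∎
      where
      b₀ b′∘f : Series
      b₀   = constant (b 0)
      b′∘f = tail b ∘ f

      b∘f : b ∘ f ≋ b₀ ⊕ (f ⊗ b′∘f)
      b∘f zero    = begin
        (b ∘ f) 0                   ≈⟨ ∘-zero b f ⟩
        b 0                         ≈⟨ +-identityʳ (b 0) ⟨
        b 0 + 0#                    ≈⟨ +-congˡ (trans (⊗₀ f b′∘f) (trans (*-congʳ f₀≈0) (zeroˡ _))) ⟨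
        b 0 + (f ⊗ b′∘f) 0          ∎
      b∘f (suc k) = trans (∘-suc b f f₀≈0 k) (sym (+-identityˡ _))

      tail-step : ∀ k → k < suc n → (tail (a ⊗ b) ∘ f) k ≈ ((a′∘f ⊗ b₀) ⊕ (a∘f ⊗ b′∘f)) k
      tail-step k k≤n = begin
        (tail (a ⊗ b) ∘ f) k
          ≈⟨ ∘-⊕ (λ j → tail a j * b 0) (a ⊗ tail b) f k ⟩
        ((λ j → tail a j * b 0) ∘ f) k + ((a ⊗ tail b) ∘ f) k
          ≈⟨ +-cong (trans (apply-*ʳ (λ i j → (f ^ j) i) (tail a) (b 0) k)
                           (sym (⊗-constʳ a′∘f b₀ (λ _ → refl) k)))
                    (rec k≤n (tail b)) ⟩
        (a′∘f ⊗ b₀) k + (a∘f ⊗ b′∘f) k ∎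

  ∘-^ : ∀ a f → f 0 ≈ 0# → ∀ j → (a ^ j) ∘ f ≋ (a ∘ f) ^ j
  ∘-^ a f f₀≈0 zero    = ∘-const 𝟙 f f₀≈0 (λ _ → refl)
  ∘-^ a f f₀≈0 (suc j) i = trans (∘-⊗ a (a ^ j) f f₀≈0 i)
    (⊗-cong {a ∘ f} {a ∘ f} {(a ^ j) ∘ f} {(a ∘ f) ^ j} (λ _ → refl) (∘-^ a f f₀≈0 j) i)

  -- Column j of the product of the two matrices of powers is `(a ^ j) ∘ f`, which is again a power,
  -- `(a ∘ f) ^ j`.
  ∘-assoc : ∀ u a f → a 0 ≈ 0# → f 0 ≈ 0# → u ∘ a ∘ f ≋ u ∘ (a ∘ f)
  ∘-assoc u a f a₀≈0 f₀≈0 i = trans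
    (apply-apply (λ i j → (f ^ j) i) u (^-lowTriangular a a₀≈0) i)
    (apply-congˡ u (λ i j → ∘-^ a f f₀≈0 j i) i)

  -- A Riordan matrix factors as the Toeplitz matrix of `g` times the matrix of powers of `f`.
  ⟪⟫· : ∀ g f {{_ : NonzeroConstant g}} {{_ : Delta f}} u → ⟪ g , f ⟫ · u ≋ g ⊗ (u ∘ f)
  ⟪⟫· g f u i = sym (apply-apply (λ i j → g (i ∸ j)) u (^-lowTriangular f f₀≈0) i)

-- The series xC(x) and its quadratic equation.

module ConjugatedInverses {c ℓ₁ ℓ₂} (K : HeytingField c ℓ₁ ℓ₂) (2#0 : TwoNonzero K) where

  open HeytingField K
  open HeytingCommutativeRing heytingCommutativeRing using (commutativeRing)
  open CommutativeRing commutativeRing using (ring; semiring)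
  open RingProperties ring using (-0#≈0#; -‿involutive)
  open SemiringMult semiring using (×1-homo-*)
  open HeytingProperties heytingCommutativeRing using (#-congʳ)
  open RiordanMatrices K 2#0
  open SeriesComposition K 2#0
  open CommutativeRingIdentities seriesRing
  open SetoidReasoning (CommutativeRing.setoid seriesRing)

  -- `2W` is bracketed as (2x)C, so that `E` and `M` coincide with the expressions in the theorem;
  -- `2W≋κ2⊗W` rebrackets it.
  W 2W E M f : Series
  W  = X ⊗ C
  2W = κ 2 ⊗ X ⊗ C
  E  = 𝟙 ⊕ 2W
  M  = 𝟙 ⊖ 2W
  f  = X ⊗ (𝟙 ⊕ X)

  W₀ : W 0 ≈ 0#
  W₀ = X⊗₀ C

  ⊝-zero : ∀ {a : Series} → a 0 ≈ 0# → (⊝ a) 0 ≈ 0#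
  ⊝-zero a₀≈0 = trans (-‿cong a₀≈0) -0#≈0#

  ∘-zero-zero : ∀ u h → u 0 ≈ 0# → (u ∘ h) 0 ≈ 0#
  ∘-zero-zero u h u₀≈0 = trans (∘-zero u h) u₀≈0

  κ2≋1+1 : κ 2 ≋ 𝟙 ⊕ 𝟙
  κ2≋1+1 zero    = +-congˡ (+-identityʳ 1#)
  κ2≋1+1 (suc _) = sym (+-identityʳ 0#)

  κ2⊗κ2≋κ4 : κ 2 ⊗ κ 2 ≋ κ 4
  κ2⊗κ2≋κ4 zero    = trans (κ⊗ 2 (κ 2) 0) (sym (×1-homo-* 2 2))
  κ2⊗κ2≋κ4 (suc n) = trans (κ⊗ 2 (κ 2) (suc n)) (zeroʳ _)

  instance
    κ2-nonzero : NonzeroConstant (κ 2)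
    κ2-nonzero = record { g₀#0 = #-congʳ (+-congˡ (sym (+-identityʳ 1#))) 2#0 }

  2W≋κ2⊗W : 2W ≋ κ 2 ⊗ W
  2W≋κ2⊗W = ⊗-assoc (κ 2) X C

  -- By the definition of `C`, 2W = 1 - s with s² = 1 - 4x. Hence (2W)² + 4x = 4W, and 4 is
  -- cancelled as two factors `κ 2`.
  W²+X≋W : (W ⊗ W) ⊕ X ≋ W
  W²+X≋W = ⊗-cancelˡ (κ 2) ((W ⊗ W) ⊕ X) W
    (⊗-cancelˡ (κ 2) (κ 2 ⊗ ((W ⊗ W) ⊕ X)) (κ 2 ⊗ W)
      (ww+k≈w+w⇒4[yy+x]≈4y (κ 2) X W κ2≋1+1 quadratic))
    where
    s : Series
    s = √ (𝟙 ⊖ κ 4 ⊗ X)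

    2W+s≋1 : 2W ⊕ s ≋ 𝟙
    -- `s 0` computes to `1#`, so 1 - s has constant term zero and its division by 2x is exact.
    2W+s≋1 n = trans (+-congʳ (/2X-correct (𝟙 ⊖ s) (-‿inverseʳ 1#) n)) (x-x+y (𝟙 n) (s n))

    s²+4X≋1 : (s ⊗ s) ⊕ (κ 4 ⊗ X) ≋ 𝟙
    s²+4X≋1 n = trans
      (+-congʳ (√-correct (𝟙 ⊖ κ 4 ⊗ X) (1-0 (trans (κ⊗ 4 X 0) (zeroʳ _))) n))
      (x-x+y (𝟙 n) ((κ 4 ⊗ X) n))

    quadratic : ((κ 2 ⊗ W) ⊗ (κ 2 ⊗ W)) ⊕ ((κ 2 ⊗ κ 2) ⊗ X) ≋ (κ 2 ⊗ W) ⊕ (κ 2 ⊗ W)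
    quadratic = w+s≈1∧ss+k≈1⇒ww+k≈w+w (κ 2 ⊗ W) s ((κ 2 ⊗ κ 2) ⊗ X)
      (λ n → trans (+-congʳ (sym (2W≋κ2⊗W n))) (2W+s≋1 n))
      (λ n → trans (+-congˡ (⊗-cong {κ 2 ⊗ κ 2} {κ 4} {X} {X} κ2⊗κ2≋κ4 (λ _ → refl) n)) (s²+4X≋1 n))

  -- Substitution into x(1+x), -x and 1+2x.

  f∘ : ∀ h → h 0 ≈ 0# → f ∘ h ≋ h ⊗ (𝟙 ⊕ h)
  f∘ h h₀≈0 = begin
    (X ⊗ (𝟙 ⊕ X)) ∘ h         ≈⟨ ∘-⊗ X (𝟙 ⊕ X) h h₀≈0 ⟩
    (X ∘ h) ⊗ ((𝟙 ⊕ X) ∘ h)   ≈⟨ ⊗-cong {X ∘ h} {h} {(𝟙 ⊕ X) ∘ h} {𝟙 ⊕ h} (X∘ h h₀≈0) [1+X]∘h ⟩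
    h ⊗ (𝟙 ⊕ h)               ∎
    where
    [1+X]∘h : (𝟙 ⊕ X) ∘ h ≋ 𝟙 ⊕ h
    [1+X]∘h n = trans (∘-⊕ 𝟙 X h n) (+-cong (∘-const 𝟙 h h₀≈0 (λ _ → refl) n) (X∘ h h₀≈0 n))

  ⊝X∘ : ∀ h → h 0 ≈ 0# → (⊝ X) ∘ h ≋ ⊝ h
  ⊝X∘ h h₀≈0 n = trans (∘-⊝ X h n) (-‿cong (X∘ h h₀≈0 n))

  [1+2X]∘ : ∀ h → h 0 ≈ 0# → (𝟙 ⊕ κ 2 ⊗ X) ∘ h ≋ 𝟙 ⊕ (κ 2 ⊗ h)
  [1+2X]∘ h h₀≈0 = begin
    (𝟙 ⊕ κ 2 ⊗ X) ∘ h              ≈⟨ ∘-⊕ 𝟙 (κ 2 ⊗ X) h ⟩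
    (𝟙 ∘ h) ⊕ ((κ 2 ⊗ X) ∘ h)      ≈⟨ (λ n → +-cong (∘-const 𝟙 h h₀≈0 (λ _ → refl) n) (2X∘h n)) ⟩
    𝟙 ⊕ (κ 2 ⊗ h)                  ∎
    where
    2X∘h : (κ 2 ⊗ X) ∘ h ≋ κ 2 ⊗ h
    2X∘h n = trans (∘-⊗ (κ 2) X h h₀≈0 n)
      (⊗-cong {κ 2 ∘ h} {κ 2} {X ∘ h} {h} (∘-const (κ 2) h h₀≈0 (λ _ → refl)) (X∘ h h₀≈0) n)

  -- Actions of `D`, `Fˢ`, `Lˢ` and of the conjugated inverses.

  ⟪𝟙⟫· : ∀ h {{_ : Delta h}} u → ⟪ 𝟙 , h ⟫ · u ≋ u ∘ h
  ⟪𝟙⟫· h u n = trans (⟪⟫· 𝟙 h u n) (⊗-identityˡ (u ∘ h) n)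

  D·≋∘ : ∀ u → D · u ≋ u ∘ (⊝ X)
  D·≋∘ = ⟪𝟙⟫· (⊝ X)

  Fˢ·≋∘ : ∀ u → Fˢ · u ≋ u ∘ f
  Fˢ·≋∘ = ⟪𝟙⟫· f

  Lˢ·≋⊗∘ : ∀ u → Lˢ · u ≋ (𝟙 ⊕ κ 2 ⊗ X) ⊗ (u ∘ f)
  Lˢ·≋⊗∘ = ⟪⟫· (𝟙 ⊕ κ 2 ⊗ X) f

  D·D· : ∀ u → D · D · u ≋ u
  D·D· u = begin
    D · D · u                    ≈⟨ D·≋∘ (D · u) ⟩
    (D · u) ∘ (⊝ X)              ≈⟨ ∘-congˡ (⊝ X) (D·≋∘ u) ⟩
    u ∘ (⊝ X) ∘ (⊝ X)            ≈⟨ ∘-assoc u (⊝ X) (⊝ X) -0#≈0# -0#≈0# ⟩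
    u ∘ ((⊝ X) ∘ (⊝ X))          ≈⟨ ∘-congʳ u (λ n → trans (⊝X∘ (⊝ X) -0#≈0# n) (-‿involutive (X n))) ⟩
    u ∘ X                        ≈⟨ ∘X u ⟩
    u                            ∎

  -- Associativity gathers the four substitutions into the single one at -f(-W) = W - W² = x.
  substitutions-cancel : ∀ q → q ∘ (⊝ X) ∘ f ∘ (⊝ X) ∘ W ≋ q
  substitutions-cancel q = begin
    q ∘ (⊝ X) ∘ f ∘ (⊝ X) ∘ W      ≈⟨ ∘-assoc (q ∘ (⊝ X) ∘ f) (⊝ X) W -0#≈0# W₀ ⟩
    q ∘ (⊝ X) ∘ f ∘ ((⊝ X) ∘ W)    ≈⟨ ∘-congʳ (q ∘ (⊝ X) ∘ f) (⊝X∘ W W₀) ⟩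
    q ∘ (⊝ X) ∘ f ∘ (⊝ W)          ≈⟨ ∘-assoc (q ∘ (⊝ X)) f (⊝ W) f₀ ⊝W₀ ⟩
    q ∘ (⊝ X) ∘ (f ∘ (⊝ W))        ≈⟨ ∘-assoc q (⊝ X) (f ∘ (⊝ W)) -0#≈0# f∘⊝W₀ ⟩
    q ∘ ((⊝ X) ∘ (f ∘ (⊝ W)))      ≈⟨ ∘-congʳ q inner ⟩
    q ∘ X                          ≈⟨ ∘X q ⟩
    q                              ∎
    where
    f₀ : f 0 ≈ 0#
    f₀ = X⊗₀ (𝟙 ⊕ X)
    ⊝W₀ : (⊝ W) 0 ≈ 0#
    ⊝W₀ = ⊝-zero {W} W₀
    f∘⊝W₀ : (f ∘ (⊝ W)) 0 ≈ 0#
    f∘⊝W₀ = ∘-zero-zero f (⊝ W) f₀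
    inner : (⊝ X) ∘ (f ∘ (⊝ W)) ≋ X
    inner n = trans (⊝X∘ (f ∘ (⊝ W)) f∘⊝W₀ n)
      (trans (-‿cong (f∘ (⊝ W) ⊝W₀ n)) (yy+x≈y⇒-[-y[1-y]]≈x X W W²+X≋W n))

  -- Substitute -W in the hypothesis. The right side becomes u(W); on the left, with q = D r,
  -- r(f(-W)) = q(-f(-W)) = q.
  conjugated-solution : ∀ g u r → g ⊗ (r ∘ f) ≋ D · u → (g ∘ (⊝ W)) ⊗ (D · r) ≋ u ∘ W
  conjugated-solution g u r g⊗[r∘f]≋D·u = begin
    (g ∘ (⊝ W)) ⊗ q
      ≈⟨ ⊗-cong {g ∘ (⊝ W)} {g ∘ (⊝ X) ∘ W} {q} {p ∘ (⊝ X) ∘ W} g∘⊝W (λ n → sym (substitutions-cancel q n)) ⟩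
    (g ∘ (⊝ X) ∘ W) ⊗ (p ∘ (⊝ X) ∘ W)
      ≈⟨ ∘-⊗ (g ∘ (⊝ X)) (p ∘ (⊝ X)) W W₀ ⟨
    ((g ∘ (⊝ X)) ⊗ (p ∘ (⊝ X))) ∘ W
      ≈⟨ ∘-congˡ W (∘-⊗ g p (⊝ X) -0#≈0#) ⟨
    (g ⊗ p) ∘ (⊝ X) ∘ W
      ≈⟨ ∘-congˡ W g⊗p∘⊝X ⟩
    u ∘ W ∎
    where
    q p : Series
    q = D · r
    p = q ∘ (⊝ X) ∘ f

    g∘⊝W : g ∘ (⊝ W) ≋ g ∘ (⊝ X) ∘ W
    g∘⊝W = begin
      g ∘ (⊝ W)           ≈⟨ ∘-congʳ g (⊝X∘ W W₀) ⟨
      g ∘ ((⊝ X) ∘ W)     ≈⟨ ∘-assoc g (⊝ X) W -0#≈0# W₀ ⟨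
      g ∘ (⊝ X) ∘ W       ∎

    r≋q∘⊝X : r ≋ q ∘ (⊝ X)
    r≋q∘⊝X = begin
      r             ≈⟨ D·D· r ⟨
      D · q         ≈⟨ D·≋∘ q ⟩
      q ∘ (⊝ X)     ∎

    g⊗p : g ⊗ p ≋ D · u
    g⊗p = begin
      g ⊗ p              ≈⟨ ⊗-cong {g} {g} {r ∘ f} {p} (λ _ → refl) (∘-congˡ f r≋q∘⊝X) ⟨
      g ⊗ (r ∘ f)        ≈⟨ g⊗[r∘f]≋D·u ⟩
      D · u              ∎

    g⊗p∘⊝X : (g ⊗ p) ∘ (⊝ X) ≋ u
    g⊗p∘⊝X = begin
      (g ⊗ p) ∘ (⊝ X)    ≈⟨ ∘-congˡ (⊝ X) g⊗p ⟩
      (D · u) ∘ (⊝ X)    ≈⟨ D·≋∘ (D · u) ⟨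
      D · D · u          ≈⟨ D·D· u ⟩
      u                  ∎

  -- This is D (g, f)⁻¹ D = (1/g(-W), W) with the denominator cleared, so no division by g(-W) is
  -- formed.
  conjugated-inverse : ∀ g A → (∀ v → A · v ≋ g ⊗ (v ∘ f)) → ∀ u →
    (g ∘ (⊝ W)) ⊗ (D · A ⁻¹ · D · u) ≋ u ∘ W
  conjugated-inverse g A A· u = conjugated-solution g u (A ⁻¹ · D · u)
    (λ n → trans (sym (A· (A ⁻¹ · D · u) n)) (⁻¹-inverseʳ A (D · u) n))

  D·Fˢ⁻¹·D· : ∀ u → D · Fˢ ⁻¹ · D · u ≋ u ∘ W
  D·Fˢ⁻¹·D· u = begin
    q                     ≈⟨ ⊗-identityˡ q ⟨
    𝟙 ⊗ q                 ≈⟨ ⊗-cong {𝟙 ∘ (⊝ W)} {𝟙} {q} {q} (∘-const 𝟙 (⊝ W) (⊝-zero {W} W₀) (λ _ → refl)) (λ _ → refl) ⟨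
    (𝟙 ∘ (⊝ W)) ⊗ q       ≈⟨ conjugated-inverse 𝟙 Fˢ (λ v n → trans (Fˢ·≋∘ v n) (sym (⊗-identityˡ (v ∘ f) n))) u ⟩
    u ∘ W                 ∎
    where
    q : Series
    q = D · Fˢ ⁻¹ · D · u

  -- The first component 1+2x of `Lˢ`, evaluated at -W, is `M`.
  M⊗[D·Lˢ⁻¹·D·] : ∀ u → M ⊗ (D · Lˢ ⁻¹ · D · u) ≋ u ∘ W
  M⊗[D·Lˢ⁻¹·D·] u = begin
    M ⊗ q                              ≈⟨ ⊗-cong {M} {g ∘ (⊝ W)} {q} {q} M≋ (λ _ → refl) ⟩
    (g ∘ (⊝ W)) ⊗ q                    ≈⟨ conjugated-inverse g Lˢ Lˢ·≋⊗∘ u ⟩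
    u ∘ W                              ∎
    where
    g q : Series
    g = 𝟙 ⊕ κ 2 ⊗ X
    q = D · Lˢ ⁻¹ · D · u
    M≋ : M ≋ g ∘ (⊝ W)
    M≋ = begin
      𝟙 ⊖ 2W              ≈⟨ (λ n → +-congˡ (-‿cong (2W≋κ2⊗W n))) ⟩
      𝟙 ⊖ κ 2 ⊗ W         ≈⟨ (λ n → +-congˡ (apply-⊝ (λ i j → κ 2 (i ∸ j)) W n)) ⟨
      𝟙 ⊕ κ 2 ⊗ (⊝ W)     ≈⟨ [1+2X]∘ (⊝ W) (⊝-zero {W} W₀) ⟨
      g ∘ (⊝ W)           ∎

  -- The relation between `y` and `z`, and the denominators.

  z∘W≋E⊗[y∘W] : ∀ v y z → y ≋ Fˢ · v → z ≋ Lˢ · v → z ∘ W ≋ E ⊗ (y ∘ W)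
  z∘W≋E⊗[y∘W] v y z y≋Fv z≋Lv = begin
    z ∘ W
      ≈⟨ ∘-congˡ W z≋Lv ⟩
    (Lˢ · v) ∘ W
      ≈⟨ ∘-congˡ W (Lˢ·≋⊗∘ v) ⟩
    ((𝟙 ⊕ κ 2 ⊗ X) ⊗ (v ∘ f)) ∘ W
      ≈⟨ ∘-⊗ (𝟙 ⊕ κ 2 ⊗ X) (v ∘ f) W W₀ ⟩
    ((𝟙 ⊕ κ 2 ⊗ X) ∘ W) ⊗ (v ∘ f ∘ W)
      ≈⟨ ⊗-cong {(𝟙 ⊕ κ 2 ⊗ X) ∘ W} {E} {v ∘ f ∘ W} {y ∘ W}
           (λ n → trans ([1+2X]∘ W W₀ n) (+-congˡ (sym (2W≋κ2⊗W n))))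
           (∘-congˡ W (λ n → sym (trans (y≋Fv n) (Fˢ·≋∘ v n)))) ⟩
    E ⊗ (y ∘ W) ∎

  M⊗E≋1-4X²C² : M ⊗ E ≋ 𝟙 ⊖ κ 4 ⊗ X ^ 2 ⊗ C ^ 2
  M⊗E≋1-4X²C² n = trans ([1-x][1+x]≈1-xx 2W n) (+-congˡ (-‿cong (2W² n)))
    where
    2W² : 2W ⊗ 2W ≋ κ 4 ⊗ X ^ 2 ⊗ C ^ 2
    2W² n = trans ([txy][txy]≈ttx²y² (κ 2) X C n)
      (⊗-cong {κ 2 ⊗ κ 2 ⊗ X ^ 2} {κ 4 ⊗ X ^ 2} {C ^ 2} {C ^ 2}
        (⊗-cong {κ 2 ⊗ κ 2} {κ 4} {X ^ 2} {X ^ 2} κ2⊗κ2≋κ4 (λ _ → refl)) (λ _ → refl) n)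

  -- Cross-multiplication, by which the quotients in (a), (b) and (d) are reduced to identities
  -- between products.
  ⊘-⊗ : ∀ a h {{_ : NonzeroConstant h}} b q → a ⊗ b ≋ h ⊗ q → (a ⊘ h) ⊗ b ≋ q
  ⊘-⊗ a h b q p = ⊗-cancelˡ h ((a ⊘ h) ⊗ b) q (begin
    h ⊗ ((a ⊘ h) ⊗ b)     ≈⟨ ⊗-assoc h (a ⊘ h) b ⟨
    h ⊗ (a ⊘ h) ⊗ b       ≈⟨ ⊗-cong {h ⊗ (a ⊘ h)} {a} {b} {b} (⊘-correct a h) (λ _ → refl) ⟩
    a ⊗ b                 ≈⟨ p ⟩
    h ⊗ q                 ∎)

  -- The four identities.

  module Relations (v y z : Series) (y≋Fv : y ≋ Fˢ · v) (z≋Lv : z ≋ Lˢ · v) where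

    private
      z∘W : z ∘ W ≋ E ⊗ (y ∘ W)
      z∘W = z∘W≋E⊗[y∘W] v y z y≋Fv z≋Lv

    part-a : ⟪ 𝟙 ⊘ (𝟙 ⊕ κ 2 ⊗ X ⊗ C) , X ⊗ C ⟫ · z ≋ D · Fˢ ⁻¹ · D · y
    part-a = begin
      ⟪ 𝟙 ⊘ E , W ⟫ · z      ≈⟨ ⟪⟫· (𝟙 ⊘ E) W z ⟩
      (𝟙 ⊘ E) ⊗ (z ∘ W)      ≈⟨ ⊘-⊗ 𝟙 E (z ∘ W) (y ∘ W) (λ n → trans (⊗-identityˡ (z ∘ W) n) (z∘W n)) ⟩
      y ∘ W                  ≈⟨ D·Fˢ⁻¹·D· y ⟨
      D · Fˢ ⁻¹ · D · y      ∎

    part-b : ⟪ 𝟙 ⊘ (𝟙 ⊖ κ 4 ⊗ X ^ 2 ⊗ C ^ 2) , X ⊗ C ⟫ · z ≋ D · Lˢ ⁻¹ · D · y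
    part-b = begin
      ⟪ 𝟙 ⊘ H , W ⟫ · z      ≈⟨ ⟪⟫· (𝟙 ⊘ H) W z ⟩
      (𝟙 ⊘ H) ⊗ (z ∘ W)      ≈⟨ ⊘-⊗ 𝟙 H (z ∘ W) q 1⊗[z∘W] ⟩
      q                      ∎
      where
      H q : Series
      H = 𝟙 ⊖ κ 4 ⊗ X ^ 2 ⊗ C ^ 2
      q = D · Lˢ ⁻¹ · D · y
      1⊗[z∘W] : 𝟙 ⊗ (z ∘ W) ≋ H ⊗ q
      1⊗[z∘W] = begin
        𝟙 ⊗ (z ∘ W)    ≈⟨ ⊗-identityˡ (z ∘ W) ⟩
        z ∘ W          ≈⟨ z∘W ⟩
        -- Writing `y ∘ W` as `M ⊗ q` brings both factors of H = (1 - 2W)(1 + 2W) in front of `q`.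
        E ⊗ (y ∘ W)    ≈⟨ ⊗-cong {E} {E} {M ⊗ q} {y ∘ W} (λ _ → refl) (M⊗[D·Lˢ⁻¹·D·] y) ⟨
        E ⊗ (M ⊗ q)    ≈⟨ ⊗-assoc E M q ⟨
        E ⊗ M ⊗ q      ≈⟨ ⊗-cong {E ⊗ M} {H} {q} {q} (λ n → trans (⊗-comm E M n) (M⊗E≋1-4X²C² n)) (λ _ → refl) ⟩
        H ⊗ q          ∎

    part-c : ⟪ 𝟙 ⊕ κ 2 ⊗ X ⊗ C , X ⊗ C ⟫ · y ≋ D · Fˢ ⁻¹ · D · z
    part-c = begin
      ⟪ E , W ⟫ · y          ≈⟨ ⟪⟫· E W y ⟩
      E ⊗ (y ∘ W)            ≈⟨ z∘W ⟨
      z ∘ W                  ≈⟨ D·Fˢ⁻¹·D· z ⟨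
      D · Fˢ ⁻¹ · D · z      ∎

    part-d : ⟪ (𝟙 ⊕ κ 2 ⊗ X ⊗ C) ⊘ (𝟙 ⊖ κ 2 ⊗ X ⊗ C) , X ⊗ C ⟫ · y ≋ D · Lˢ ⁻¹ · D · z
    part-d = begin
      ⟪ E ⊘ M , W ⟫ · y      ≈⟨ ⟪⟫· (E ⊘ M) W y ⟩
      -- After clearing the denominator `M`, both sides equal `z ∘ W`.
      (E ⊘ M) ⊗ (y ∘ W)      ≈⟨ ⊘-⊗ E M (y ∘ W) (D · Lˢ ⁻¹ · D · z)
                                  (λ n → trans (sym (z∘W n)) (sym (M⊗[D·Lˢ⁻¹·D·] z n))) ⟩
      D · Lˢ ⁻¹ · D · z      ∎

theorem4p5 : ∀ {c ℓ₁ ℓ₂} (K : HeytingField c ℓ₁ ℓ₂) (2#0 : TwoNonzero K) →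
    let open RiordanMatrices K 2#0 in
    (v y z : Series) → y ≋ Fˢ · v → z ≋ Lˢ · v →
    (⟪ 𝟙 ⊘ (𝟙 ⊕ κ 2 ⊗ X ⊗ C) , X ⊗ C ⟫ · z ≋ D · Fˢ ⁻¹ · D · y)
    × (⟪ 𝟙 ⊘ (𝟙 ⊖ κ 4 ⊗ X ^ 2 ⊗ C ^ 2) , X ⊗ C ⟫ · z ≋ D · Lˢ ⁻¹ · D · y)
    × (⟪ 𝟙 ⊕ κ 2 ⊗ X ⊗ C , X ⊗ C ⟫ · y ≋ D · Fˢ ⁻¹ · D · z)
    × (⟪ (𝟙 ⊕ κ 2 ⊗ X ⊗ C) ⊘ (𝟙 ⊖ κ 2 ⊗ X ⊗ C) , X ⊗ C ⟫ · y ≋ D · Lˢ ⁻¹ · D · z)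
theorem4p5 K 2#0 v y z y≋Fv z≋Lv = part-a , part-b , part-c , part-d
  where
  open ConjugatedInverses K 2#0
  open Relations v y z y≋Fv z≋Lv
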